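{- Let $\alpha,\beta$ be real (or complex) parameters and let $n,k$ be non-negative integers. Let $\Omega_{n,k}$ be the set of all partitions of $\{1,\ldots,n\}$ into $k$ non-empty blocks, the blocks being unordered among themselves but each block being arranged as a linear list (sequence). For $\varepsilon\in\Omega_{n,k}$ define its weight $w(\varepsilon)$ as the product over all elements $e\in\{1,\ldots,n\}$ of the weight of $e$, where an element $e$ has weight $1$ if $e$ is the smallest element of its list, weight $\beta$ if $e$ is not the smallest element of its list but appears in the list before every element of its list that is smaller than $e$, and weight $\alpha$ otherwise. (Equivalently, the lists are built by inserting $1,2,\ldots,n$ one at a time: starting a new list costs $1$, inserting at the head of an existing list costs $\beta$, inserting immediately after an already placed element costs $\alpha$.) Then $$\genfrac{\lfloor}{\rfloor}{0pt}{}{n}{k}^{\alpha,\beta}=\sum_{\varepsilon\in\Omega_{n,k}} w(\varepsilon).$$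
   Context: For parameters $\alpha,\beta$, the generalized Stirling (Lah-type) numbers $\genfrac{\lfloor}{\rfloor}{0pt}{}{n}{k}^{\alpha,\beta}$, $0\le k\le n$, are defined by the polynomial identity in $x$ $$x(x+\alpha)(x+2\alpha)\cdots(x+(n-1)\alpha)=\sum_{k=0}^{n}\genfrac{\lfloor}{\rfloor}{0pt}{}{n}{k}^{\alpha,\beta}\,x(x-\beta)(x-2\beta)\cdots(x-(k-1)\beta),$$ (empty products equal $1$), and $\genfrac{\lfloor}{\rfloor}{0pt}{}{n}{k}^{\alpha,\beta}=0$ for $k<0$ or $k>n$. In particular $\genfrac{\lfloor}{\rfloor}{0pt}{}{0}{0}^{\alpha,\beta}=1$ and $\genfrac{\lfloor}{\rfloor}{0pt}{}{n}{0}^{\alpha,\beta}=0$ for $n\ge1$. -}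

module Defs where

open import Algebra.Bundles using (CommutativeRing)
open import Data.Bool.Base using (if_then_else_)
open import Data.Fin.Base using (Fin; _≤_; _<_)
open import Data.Fin.Properties using (_≟_; _≤?_; _<?_)
open import Data.List.Base using (List; []; _∷_; map; foldr; length; concat; upTo; allFin)
open import Data.List.Membership.Propositional.Properties using (∈-allFin; ∈-concat⁻′)
open import Data.List.Relation.Binary.Permutation.Propositional using (_↭_; ↭-refl; ↭-sym; ↭-trans)
open import Data.List.Relation.Binary.Permutation.Propositional.Properties using (∈-resp-↭)
open import Data.List.Relation.Binary.Sublist.DecPropositional using (_⊆?_)
open import Data.List.Relation.Binary.Sublist.Propositional using (_⊆_)
open import Data.List.Relation.Unary.All using (All; all?)
open import Data.List.Relation.Unary.Enumerates.Setoid using (IsEnumeration)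
open import Data.List.Relation.Unary.Unique.Setoid using (Unique)
open import Data.Nat.Base as ℕ using (ℕ; zero; suc)
open import Data.Product.Base using (proj₁)
open import Level using (Level; 0ℓ; _⊔_)
open import Relation.Binary.Bundles using (Setoid)
open import Relation.Binary.PropositionalEquality.Core using (_≡_; _≢_)
open import Relation.Nullary.Decidable.Core using (Dec; does; _→-dec_)

-- An element of Ω n k, with {1,…,n} represented by Fin n.

record ListPartition (n k : ℕ) : Set where
  field
    lists    : List (List (Fin n))
    count    : length lists ≡ k
    nonEmpty : All (_≢ []) lists
    covers   : concat lists ↭ allFin n

open ListPartition public

-- The lists of a partition are unordered among themselves, whereas the order
-- inside each list matters.

Ω : ℕ → ℕ → Setoid 0ℓ 0ℓ
Ω n k = record
  { Carrier       = ListPartition n k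
  ; _≈_           = λ ε ε′ → lists ε ↭ lists ε′
  ; isEquivalence = record { refl = ↭-refl ; sym = ↭-sym ; trans = ↭-trans }
  }

record Enumeration {a ℓ : Level} (S : Setoid a ℓ) : Set (a ⊔ ℓ) where
  field
    elements : List (Setoid.Carrier S)
    complete : IsEnumeration S elements
    unique   : Unique S elements

open Enumeration public

listOf : ∀ {n k} → ListPartition n k → Fin n → List (Fin n)
listOf ε e =
  proj₁ (∈-concat⁻′ (lists ε) (∈-resp-↭ (↭-sym (covers ε)) (∈-allFin e)))

-- Both predicates below are only meant for an e that occurs in l.

Smallest : ∀ {n} → List (Fin n) → Fin n → Set
Smallest l e = All (λ d → e ≤ d) l

smallest? : ∀ {n} (l : List (Fin n)) (e : Fin n) → Dec (Smallest l e)
smallest? l e = all? (λ d → e ≤? d) l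

-- _⊆_ is the order-preserving sublist relation, so e ∷ d ∷ [] ⊆ l says that
-- e appears before d in l.

PrecedesSmaller : ∀ {n} → List (Fin n) → Fin n → Set
PrecedesSmaller l e = All (λ d → d < e → (e ∷ d ∷ []) ⊆ l) l

precedesSmaller? : ∀ {n} (l : List (Fin n)) (e : Fin n) → Dec (PrecedesSmaller l e)
precedesSmaller? l e =
  all? (λ d → (d <? e) →-dec (_⊆?_ _≟_ (e ∷ d ∷ []) l)) l

module _ {c ℓ : Level} (R : CommutativeRing c ℓ) where

  open CommutativeRing R
  open import Algebra.Definitions.RawMonoid +-rawMonoid using (_×_)

  elementWeight : ∀ {n} → Carrier → Carrier → List (Fin n) → Fin n → Carrier
  elementWeight α β l e =
    if does (smallest? l e) then 1#
    else if does (precedesSmaller? l e) then β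
    else α

  weight : ∀ {n k} → Carrier → Carrier → ListPartition n k → Carrier
  weight {n} α β ε =
    foldr _*_ 1# (map (λ e → elementWeight α β (listOf ε e) e) (allFin n))

  sumOver : ∀ {a r} {S : Setoid a r} →
            Enumeration S → (Setoid.Carrier S → Carrier) → Carrier
  sumOver E f = foldr _+_ 0# (map f (elements E))

  -- Polynomials in x over R: coefficient lists, constant term first.  Trailing
  -- zeros are allowed, so equality is coefficientwise.

  Poly : Set c
  Poly = List Carrier

  coeff : Poly → ℕ → Carrier
  coeff []      _       = 0#
  coeff (a ∷ p) zero    = a
  coeff (a ∷ p) (suc i) = coeff p i

  _≈ᴾ_ : Poly → Poly → Set ℓ
  p ≈ᴾ q = ∀ i → coeff p i ≈ coeff q i

  _+ᴾ_ : Poly → Poly → Poly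
  []      +ᴾ q       = q
  (a ∷ p) +ᴾ []      = a ∷ p
  (a ∷ p) +ᴾ (b ∷ q) = (a + b) ∷ (p +ᴾ q)

  _·ᴾ_ : Carrier → Poly → Poly
  a ·ᴾ p = map (a *_) p

  _*ᴾ_ : Poly → Poly → Poly
  []      *ᴾ q = []
  (a ∷ p) *ᴾ q = (a ·ᴾ q) +ᴾ (0# ∷ (p *ᴾ q))

  sumᴾ : List Poly → Poly
  sumᴾ = foldr _+ᴾ_ []

  productᴾ : List Poly → Poly
  productᴾ = foldr _*ᴾ_ (1# ∷ [])

  x+_ : Carrier → Poly
  x+ a = a ∷ 1# ∷ []

  -- x (x + α) ⋯ (x + (n-1) α)
  rising : Carrier → ℕ → Poly
  rising α n = productᴾ (map (λ i → x+ (i × α)) (upTo n))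

  -- x (x - β) ⋯ (x - (k-1) β)
  falling : Carrier → ℕ → Poly
  falling β k = productᴾ (map (λ i → x+ (- (i × β))) (upTo k))

  -- S n k are the generalized Stirling numbers with parameters α and β.  The
  -- identity determines them for k ≤ n, since falling β k is monic of degree k.
  record IsGeneralizedStirling (α β : Carrier) (S : ℕ → ℕ → Carrier) : Set (c ⊔ ℓ) where
    field
      identity : ∀ n →
        rising α n ≈ᴾ sumᴾ (map (λ k → S n k ·ᴾ falling β k) (upTo (suc n)))
      vanishes : ∀ n k → n ℕ.< k → S n k ≈ 0#

{-# OPTIONS --safe #-}

-- Both sides satisfy T (n+1) k = T n (k-1) + (kβ + nα) T n k.  For the Stirling
-- numbers this comes from x + nα = (x - kβ) + (kβ + nα), and the expansion in
-- the basis x (x - β) ⋯ (x - (k-1)β) is unique because these polynomials are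
-- monic.  For the weighted sum it comes from inserting a new largest element:
-- it does not change the weights of the others, and has weight 1 as a new list,
-- β at the head of one of the k lists, and α after one of the n elements.

module Submission where

open import Defs
open import Algebra.Bundles using (CommutativeRing)
import Algebra.Solver.Ring.NaturalCoefficients.Default as SemiringSolver
open import Data.Bool.Base using (if_then_else_)
open import Data.Fin.Base as Fin using (Fin)
import Data.Fin.Properties as Fin
open import Data.List.Base
  using (List; []; _∷_; _++_; _∷ʳ_; [_]; map; length; concat; concatMap; foldr; upTo; allFin; reverse)
open import Data.List.Membership.Propositional using (_∈_; _∉_; lose)
open import Data.List.Membership.Propositional.Properties
  using (∈-∃++; ∈-++⁺ˡ; ∈-++⁺ʳ; ∈-++⁻; ∈-map⁺; ∈-map⁻; ∈-concat⁺′; ∈-concat⁻′; ∈-concatMap⁺; ∈-insert; ∈-allFin)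
import Data.List.Membership.Setoid as ∈ₛ
import Data.List.Membership.Setoid.Properties as SetoidMembership
open import Data.List.Properties
  using (map-++; map-∘; ∷-injectiveˡ; ∷-injectiveʳ; length-++; length-map; length-reverse; length-tabulate
        ; unfold-reverse; upTo-∷ʳ)
open import Data.List.Relation.Binary.Permutation.Propositional as Permutation
  using (_↭_; ↭-refl; ↭-prep; ↭-swap; ↭-sym; ↭-trans; ↭⇒↭ₛ; ↭⇒↭ₛ′; module PermutationReasoning)
open import Data.List.Relation.Binary.Permutation.Propositional.Properties
  using (++⁺ˡ; ++⁺ʳ; shift; shifts; drop-∷; drop-mid; ∈-resp-↭; All-resp-↭; ↭-length; ↭-reverse; ¬x∷xs↭[])
  renaming (map⁺ to ↭-map⁺)
import Data.List.Relation.Binary.Permutation.Setoid as ↭ₛ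
import Data.List.Relation.Binary.Permutation.Setoid.Properties as SetoidPermutation
open import Data.List.Relation.Binary.Sublist.Propositional as Sublist
  using (_⊆_; ⊆-refl; ⊆-trans; from∈; lookup)
open import Data.List.Relation.Binary.Sublist.Propositional.Properties using (++⁺)
open import Data.List.Relation.Unary.All as All using (All; []; _∷_)
import Data.List.Relation.Unary.All.Properties as All
open import Data.List.Relation.Unary.AllPairs as AllPairs using (AllPairs; []; _∷_)
import Data.List.Relation.Unary.AllPairs.Properties as AllPairs
open import Data.List.Relation.Unary.Any as Any using (Any; here; there)
import Data.List.Relation.Unary.Any.Properties as Any
open import Data.List.Relation.Unary.Unique.Propositional using (Unique)
import Data.List.Relation.Unary.Unique.Setoid as SetoidUnique
open import Data.Nat.Base as ℕ using (ℕ; zero; suc; s≤s)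
import Data.Nat.Properties as ℕ
open import Data.Product.Base using (_×_; _,_; ∃; ∃₂)
open import Data.Sum.Base using (inj₁; inj₂; [_,_]′)
open import Function.Base using (_∘_; flip)
open import Function.Bundles using (mk⇔)
open import Level using (Level)
open import Relation.Binary.Bundles using (Setoid)
open import Relation.Binary.PropositionalEquality as ≡ using (_≡_; _≢_)
open import Relation.Nullary.Decidable using (does-⇔; dec-true; dec-false)
open import Relation.Nullary.Negation using (¬_; contradiction)

-- The defining identity is one of formal polynomials over an arbitrary commutative ring, where
-- values at points need not determine coefficients. The algebra therefore works on coefficient
-- sequences, with multiplication by x + a as the operator `_⊛_`. On the combinatorial side the
-- obstacle is that partitions are compared up to the order of their lists, whereas a recursion
-- produces concrete lists of lists. Completeness and absence of repetition must hold modulo `_↭_`,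
-- and so must the reversibility of insertion: the inserted element occurs exactly once, so deleting
-- it is unambiguous. Any two enumerations are then permutations of each other, and only the sum
-- over a concrete one has to be computed.

private variable
  a b p r : Level
  A : Set a
  B : Set b
  x y : A
  xs ys l m : List A
  ls ms ls′ ms′ : List (List A)
  n k : ℕ

-- The recurrence for the generalized Stirling numbers

module Polynomials {c ℓ : Level} (R : CommutativeRing c ℓ) where

  open CommutativeRing R hiding (zero)
  open import Algebra.Definitions.RawMonoid +-rawMonoid using () renaming (_×_ to _·_)
  open import Algebra.Properties.Ring ring using (+-cancelʳ)
  open import Relation.Binary.Reasoning.Setoid setoid
  open SemiringSolver commutativeSemiring using (solve; _:=_; _:+_; _:*_)

  -- The last index is split off, matching `upTo-∷ʳ` and the top-coefficient argument in
  -- `∑-monic-injective`.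
  ∑ : ℕ → (ℕ → Carrier) → Carrier
  ∑ zero    f = 0#
  ∑ (suc m) f = ∑ m f + f m

  ∑-cong : ∀ m {f g} → (∀ k → k ℕ.< m → f k ≈ g k) → ∑ m f ≈ ∑ m g
  ∑-cong zero    f≈g = refl
  ∑-cong (suc m) f≈g = +-cong (∑-cong m (λ k k<m → f≈g k (ℕ.m<n⇒m<1+n k<m))) (f≈g m ℕ.≤-refl)

  ∑-distrib-+ : ∀ m f g → ∑ m (λ k → f k + g k) ≈ ∑ m f + ∑ m g
  ∑-distrib-+ zero    f g = sym (+-identityˡ 0#)
  ∑-distrib-+ (suc m) f g = trans (+-congʳ (∑-distrib-+ m f g))
    (solve 4 (λ a b c d → (a :+ b) :+ (c :+ d) := (a :+ c) :+ (b :+ d)) refl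
      (∑ m f) (∑ m g) (f m) (g m))

  ∑-distribˡ-* : ∀ m a f → a * ∑ m f ≈ ∑ m (λ k → a * f k)
  ∑-distribˡ-* zero    a f = zeroʳ a
  ∑-distribˡ-* (suc m) a f = trans (distribˡ a _ _) (+-congʳ (∑-distribˡ-* m a f))

  ∑-zero : ∀ m {f} → (∀ k → k ℕ.< m → f k ≈ 0#) → ∑ m f ≈ 0#
  ∑-zero zero    f≈0 = refl
  ∑-zero (suc m) f≈0 = trans
    (+-cong (∑-zero m (λ k k<m → f≈0 k (ℕ.m<n⇒m<1+n k<m))) (f≈0 m ℕ.≤-refl))
    (+-identityˡ 0#)

  ∑-head : ∀ m f → ∑ (suc m) f ≈ f 0 + ∑ m (λ k → f (suc k))
  ∑-head zero    f = +-comm 0# (f 0)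
  ∑-head (suc m) f = trans (+-congʳ (∑-head m f)) (+-assoc _ _ _)

  infixr 7 _⊛_

  -- Multiplication by x + a on coefficient sequences.
  _⊛_ : Carrier → (ℕ → Carrier) → ℕ → Carrier
  (a ⊛ q) zero    = a * q zero
  (a ⊛ q) (suc i) = a * q (suc i) + q i

  ⊛-cong : ∀ a {p q} → (∀ i → p i ≈ q i) → ∀ i → (a ⊛ p) i ≈ (a ⊛ q) i
  ⊛-cong a p≈q zero    = *-congˡ (p≈q zero)
  ⊛-cong a p≈q (suc i) = +-cong (*-congˡ (p≈q (suc i))) (p≈q i)

  -- Each coefficient of the double product involves at most three consecutive coefficients of `q`;
  -- the cases are how many of them exist.
  ⊛-comm : ∀ a b q i → (a ⊛ b ⊛ q) i ≈ (b ⊛ a ⊛ q) i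
  ⊛-comm a b q zero = solve 3 (λ a b u → a :* (b :* u) := b :* (a :* u)) refl a b (q 0)
  ⊛-comm a b q (suc zero) = solve 4 (λ a b u v →
    a :* (b :* v :+ u) :+ b :* u := b :* (a :* v :+ u) :+ a :* u) refl a b (q 0) (q 1)
  ⊛-comm a b q (suc (suc i)) = solve 5 (λ a b u v w →
    a :* (b :* w :+ v) :+ (b :* v :+ u) := b :* (a :* w :+ v) :+ (a :* v :+ u)) refl
      a b (q i) (q (suc i)) (q (suc (suc i)))

  ⊛-∑ : ∀ a m (s : ℕ → Carrier) (F : ℕ → ℕ → Carrier) i →
        (a ⊛ λ j → ∑ m (λ k → s k * F k j)) i ≈ ∑ m (λ k → s k * (a ⊛ F k) i)
  ⊛-∑ a m s F zero = trans (∑-distribˡ-* m a _) (∑-cong m λ k _ →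
    solve 3 (λ a s u → a :* (s :* u) := s :* (a :* u)) refl a (s k) (F k 0))
  ⊛-∑ a m s F (suc i) = begin
    a * ∑ m (λ k → s k * F k (suc i)) + ∑ m (λ k → s k * F k i)
      ≈⟨ +-congʳ (∑-distribˡ-* m a _) ⟩
    ∑ m (λ k → a * (s k * F k (suc i))) + ∑ m (λ k → s k * F k i)
      ≈⟨ ∑-distrib-+ m _ _ ⟨
    ∑ m (λ k → a * (s k * F k (suc i)) + s k * F k i)
      ≈⟨ ∑-cong m (λ k _ → solve 4 (λ a s u v → a :* (s :* v) :+ s :* u := s :* (a :* v :+ u)) refl
           a (s k) (F k i) (F k (suc i))) ⟩
    ∑ m (λ k → s k * (a ⊛ F k) (suc i)) ∎

  -- Coefficients of sums and of products of linear factors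

  coeff-+ᴾ : ∀ p q i → coeff R (_+ᴾ_ R p q) i ≈ coeff R p i + coeff R q i
  coeff-+ᴾ []      q       i       = sym (+-identityˡ _)
  coeff-+ᴾ (a ∷ p) []      i       = sym (+-identityʳ _)
  coeff-+ᴾ (a ∷ p) (b ∷ q) zero    = refl
  coeff-+ᴾ (a ∷ p) (b ∷ q) (suc i) = coeff-+ᴾ p q i

  coeff-·ᴾ : ∀ a p i → coeff R (_·ᴾ_ R a p) i ≈ a * coeff R p i
  coeff-·ᴾ a []      i       = sym (zeroʳ a)
  coeff-·ᴾ a (b ∷ p) zero    = refl
  coeff-·ᴾ a (b ∷ p) (suc i) = coeff-·ᴾ a p i

  coeff-x+ : ∀ a q i → coeff R (_*ᴾ_ R (x+_ R a) q) i ≈ (a ⊛ coeff R q) i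
  coeff-x+ a q zero = trans (coeff-+ᴾ (_·ᴾ_ R a q) _ zero)
    (trans (+-identityʳ _) (coeff-·ᴾ a q zero))
  coeff-x+ a q (suc i) = trans (coeff-+ᴾ (_·ᴾ_ R a q) _ (suc i))
    -- Multiplying the tail `1# ∷ []` by `q` gives `1# ·ᴾ q` plus a leftover zero polynomial
    -- `0# ∷ []`, which comes from the shifted empty product.
    (+-cong (coeff-·ᴾ a q (suc i)) (begin
      coeff R (_+ᴾ_ R (_·ᴾ_ R 1# q) (0# ∷ [])) i  ≈⟨ coeff-+ᴾ (_·ᴾ_ R 1# q) _ i ⟩
      coeff R (_·ᴾ_ R 1# q) i + coeff R (0# ∷ []) i ≈⟨ +-cong (coeff-·ᴾ 1# q i) (zeros i) ⟩
      1# * coeff R q i + 0#                       ≈⟨ +-identityʳ _ ⟩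
      1# * coeff R q i                            ≈⟨ *-identityˡ _ ⟩
      coeff R q i                                 ∎))
    where
    zeros : ∀ i → coeff R (0# ∷ []) i ≈ 0#
    zeros zero    = refl
    zeros (suc i) = refl

  linearProduct : (ℕ → Carrier) → List ℕ → Poly R
  linearProduct a is = productᴾ R (map (λ i → x+_ R (a i)) is)

  -- `productᴾ` has its first factor outermost, but induction on the number of factors appends one
  -- at the end. Commutativity of linear factors carries the new one outwards.
  linearProduct-∷ʳ : ∀ a is k i →
    coeff R (linearProduct a (is ∷ʳ k)) i ≈ (a k ⊛ coeff R (linearProduct a is)) i
  linearProduct-∷ʳ a []       k i = coeff-x+ (a k) (1# ∷ []) i
  linearProduct-∷ʳ a (j ∷ is) k i = begin
    coeff R (linearProduct a (j ∷ is ∷ʳ k)) i         ≈⟨ coeff-x+ (a j) (linearProduct a (is ∷ʳ k)) i ⟩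
    (a j ⊛ coeff R (linearProduct a (is ∷ʳ k))) i     ≈⟨ ⊛-cong (a j) (linearProduct-∷ʳ a is k) i ⟩
    (a j ⊛ a k ⊛ coeff R (linearProduct a is)) i      ≈⟨ ⊛-comm (a j) (a k) _ i ⟩
    (a k ⊛ a j ⊛ coeff R (linearProduct a is)) i      ≈⟨ ⊛-cong (a k) (coeff-x+ (a j) (linearProduct a is)) i ⟨
    (a k ⊛ coeff R (linearProduct a (j ∷ is))) i      ∎

  linearProduct-upTo-suc : ∀ a n i →
    coeff R (linearProduct a (upTo (suc n))) i ≈ (a n ⊛ coeff R (linearProduct a (upTo n))) i
  linearProduct-upTo-suc a n i =
    ≡.subst (λ is → coeff R (linearProduct a is) i ≈ (a n ⊛ coeff R (linearProduct a (upTo n))) i)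
      (upTo-∷ʳ n) (linearProduct-∷ʳ a (upTo n) n i)

  linearProduct-degree : ∀ a n {i} → n ℕ.< i → coeff R (linearProduct a (upTo n)) i ≈ 0#
  linearProduct-degree a zero    {suc i} _         = refl
  linearProduct-degree a (suc n) {suc i} (s≤s n<i) = begin
    coeff R (linearProduct a (upTo (suc n))) (suc i)           ≈⟨ linearProduct-upTo-suc a n (suc i) ⟩
    (a n ⊛ coeff R (linearProduct a (upTo n))) (suc i)
      ≈⟨ +-cong (*-congˡ (linearProduct-degree a n (ℕ.m<n⇒m<1+n n<i))) (linearProduct-degree a n n<i) ⟩
    a n * 0# + 0#                                              ≈⟨ +-identityʳ _ ⟩
    a n * 0#                                                   ≈⟨ zeroʳ _ ⟩
    0#                                                         ∎

  linearProduct-monic : ∀ a n → coeff R (linearProduct a (upTo n)) n ≈ 1#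
  linearProduct-monic a zero    = refl
  linearProduct-monic a (suc n) = begin
    coeff R (linearProduct a (upTo (suc n))) (suc n)           ≈⟨ linearProduct-upTo-suc a n (suc n) ⟩
    (a n ⊛ coeff R (linearProduct a (upTo n))) (suc n)         ≈⟨ +-cong (*-congˡ (linearProduct-degree a n ℕ.≤-refl)) (linearProduct-monic a n) ⟩
    a n * 0# + 1#                                              ≈⟨ +-congʳ (zeroʳ _) ⟩
    0# + 1#                                                    ≈⟨ +-identityˡ 1# ⟩
    1#                                                         ∎

  coeff-sumᴾ-∷ʳ : ∀ ps q i → coeff R (sumᴾ R (ps ∷ʳ q)) i ≈ coeff R (sumᴾ R ps) i + coeff R q i
  coeff-sumᴾ-∷ʳ []       q i = trans (coeff-+ᴾ q [] i) (+-comm _ _)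
  coeff-sumᴾ-∷ʳ (p ∷ ps) q i = begin
    coeff R (sumᴾ R (p ∷ ps ∷ʳ q)) i                        ≈⟨ coeff-+ᴾ p _ i ⟩
    coeff R p i + coeff R (sumᴾ R (ps ∷ʳ q)) i              ≈⟨ +-congˡ (coeff-sumᴾ-∷ʳ ps q i) ⟩
    coeff R p i + (coeff R (sumᴾ R ps) i + coeff R q i)     ≈⟨ +-assoc _ _ _ ⟨
    (coeff R p i + coeff R (sumᴾ R ps) i) + coeff R q i     ≈⟨ +-congʳ (coeff-+ᴾ p _ i) ⟨
    coeff R (sumᴾ R (p ∷ ps)) i + coeff R q i               ∎

  coeff-sumᴾ-upTo : ∀ (p : ℕ → Poly R) m i →
    coeff R (sumᴾ R (map p (upTo m))) i ≈ ∑ m (λ k → coeff R (p k) i)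
  coeff-sumᴾ-upTo p zero    i = refl
  coeff-sumᴾ-upTo p (suc m) i = begin
    coeff R (sumᴾ R (map p (upTo (suc m)))) i               ≡⟨ ≡.cong (λ ps → coeff R (sumᴾ R ps) i) last ⟩
    coeff R (sumᴾ R (map p (upTo m) ∷ʳ p m)) i              ≈⟨ coeff-sumᴾ-∷ʳ (map p (upTo m)) (p m) i ⟩
    coeff R (sumᴾ R (map p (upTo m))) i + coeff R (p m) i   ≈⟨ +-congʳ (coeff-sumᴾ-upTo p m i) ⟩
    ∑ (suc m) (λ k → coeff R (p k) i)                       ∎
    where
    last : map p (upTo (suc m)) ≡ map p (upTo m) ∷ʳ p m
    last = ≡.trans (≡.cong (map p) (≡.sym (upTo-∷ʳ m))) (map-++ p (upTo m) (m ∷ []))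

  -- The top coefficient of a combination of monic polynomials of degrees
  -- 0, …, m - 1 is its last coordinate.
  ∑-monic-injective : ∀ (F : ℕ → ℕ → Carrier) →
    (∀ k → F k k ≈ 1#) → (∀ k {i} → k ℕ.< i → F k i ≈ 0#) →
    ∀ m (s t : ℕ → Carrier) → (∀ i → ∑ m (λ k → s k * F k i) ≈ ∑ m (λ k → t k * F k i)) →
    ∀ k → k ℕ.< m → s k ≈ t k
  ∑-monic-injective F monic degree (suc m) s t eq k (s≤s k≤m) =
    [ ∑-monic-injective F monic degree m s t lower k
    , (λ { ≡.refl → sm≈tm }) ]′ (ℕ.m≤n⇒m<n∨m≡n k≤m)
    where
    top : ∀ u → ∑ (suc m) (λ k → u k * F k m) ≈ u m
    top u = begin
      ∑ m (λ k → u k * F k m) + u m * F m m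
        ≈⟨ +-cong (∑-zero m (λ k k<m → trans (*-congˡ (degree k k<m)) (zeroʳ _))) (*-congˡ (monic m)) ⟩
      0# + u m * 1#                         ≈⟨ +-identityˡ _ ⟩
      u m * 1#                              ≈⟨ *-identityʳ _ ⟩
      u m                                   ∎
    sm≈tm : s m ≈ t m
    sm≈tm = trans (sym (top s)) (trans (eq m) (top t))
    lower : ∀ i → ∑ m (λ k → s k * F k i) ≈ ∑ m (λ k → t k * F k i)
    lower i = +-cancelʳ (t m * F m i) _ _ (trans (+-congˡ (*-congʳ (sym sm≈tm))) (eq i))

  -- The triangular recurrence and its uniqueness

  module _ (α β : Carrier) where

    -- The total cost of inserting a new largest element into k lists that hold
    -- n elements: k positions at a head and n positions after an element.
    weightSum : ℕ → ℕ → Carrier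
    weightSum n k = k · β + n · α

    -- The recurrence shared by both sides serves as a definition, so that each side is compared
    -- with it separately. In column 0 there is no entry to the left, so only the insertion term
    -- remains.
    triangle : ℕ → ℕ → Carrier
    triangle zero    zero    = 1#
    triangle zero    (suc k) = 0#
    triangle (suc n) zero    = weightSum n zero * triangle n zero
    triangle (suc n) (suc k) = triangle n k + weightSum n (suc k) * triangle n (suc k)

    triangle-vanishes : ∀ n k → n ℕ.< k → triangle n k ≈ 0#
    triangle-vanishes zero    (suc k) _         = refl
    triangle-vanishes (suc n) (suc k) (s≤s n<k) = begin
      triangle n k + weightSum n (suc k) * triangle n (suc k)
        ≈⟨ +-cong (triangle-vanishes n k n<k) (*-congˡ (triangle-vanishes n (suc k) (ℕ.m<n⇒m<1+n n<k))) ⟩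
      0# + weightSum n (suc k) * 0#
        ≈⟨ +-identityˡ _ ⟩
      weightSum n (suc k) * 0#
        ≈⟨ zeroʳ _ ⟩
      0# ∎

    φ : ℕ → ℕ → Carrier
    φ k = coeff R (falling R β k)

    ⊛-falling : ∀ n k i → (n · α ⊛ φ k) i ≈ φ (suc k) i + weightSum n k * φ k i
    ⊛-falling n k i = begin
      (n · α ⊛ φ k) i                                   ≈⟨ split i ⟩
      ((- (k · β)) ⊛ φ k) i + weightSum n k * φ k i     ≈⟨ +-congʳ (linearProduct-upTo-suc (λ j → - (j · β)) k i) ⟨
      φ (suc k) i + weightSum n k * φ k i               ∎
      where
      scalar : ∀ u → n · α * u ≈ - (k · β) * u + weightSum n k * u
      scalar u = begin
        n · α * u                                   ≈⟨ *-congʳ (+-identityˡ _) ⟨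
        (0# + n · α) * u                            ≈⟨ *-congʳ (+-congʳ (-‿inverseˡ (k · β))) ⟨
        (- (k · β) + k · β + n · α) * u
          ≈⟨ solve 4 (λ m b a u → (m :+ b :+ a) :* u := m :* u :+ (b :+ a) :* u) refl
               (- (k · β)) (k · β) (n · α) u ⟩
        - (k · β) * u + weightSum n k * u           ∎
      split : ∀ i → (n · α ⊛ φ k) i ≈ ((- (k · β)) ⊛ φ k) i + weightSum n k * φ k i
      split zero    = scalar (φ k 0)
      split (suc i) = trans (+-congʳ (scalar (φ k (suc i))))
        (solve 3 (λ a b c → (a :+ b) :+ c := (a :+ c) :+ b) refl _ _ _)

    rising-expansion : ∀ n i → coeff R (rising R α n) i ≈ ∑ (suc n) (λ k → triangle n k * φ k i)
    rising-expansion zero i = begin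
      φ 0 i                   ≈⟨ *-identityˡ _ ⟨
      1# * φ 0 i              ≈⟨ +-identityˡ _ ⟨
      0# + 1# * φ 0 i         ∎
    rising-expansion (suc n) i = begin
      coeff R (rising R α (suc n)) i
        ≈⟨ linearProduct-upTo-suc (_· α) n i ⟩
      (n · α ⊛ coeff R (rising R α n)) i
        ≈⟨ ⊛-cong (n · α) (rising-expansion n) i ⟩
      (n · α ⊛ λ j → ∑ (suc n) (λ k → triangle n k * φ k j)) i
        ≈⟨ ⊛-∑ (n · α) (suc n) (triangle n) φ i ⟩
      ∑ (suc n) (λ k → triangle n k * (n · α ⊛ φ k) i)
        ≈⟨ ∑-cong (suc n) (λ k _ → trans (*-congˡ (⊛-falling n k i)) (distribˡ _ _ _)) ⟩
      ∑ (suc n) (λ k → triangle n k * φ (suc k) i + triangle n k * (weightSum n k * φ k i))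
        ≈⟨ ∑-distrib-+ (suc n) _ _ ⟩
      ∑ (suc n) (λ k → triangle n k * φ (suc k) i) + ∑ (suc n) (λ k → triangle n k * (weightSum n k * φ k i))
        -- The second sum is given one more term, of index `suc n`, which is zero by
        -- `triangle-vanishes`. Splitting off index 0 at the other end then aligns both sums on
        -- `φ (suc k)`.
        ≈⟨ +-congˡ (+-identityʳ _) ⟨
      ∑ (suc n) (λ k → triangle n k * φ (suc k) i) +
        (∑ (suc n) (λ k → triangle n k * (weightSum n k * φ k i)) + 0#)
        ≈⟨ +-congˡ (+-congˡ (trans (*-congʳ (triangle-vanishes n (suc n) ℕ.≤-refl)) (zeroˡ _))) ⟨
      ∑ (suc n) (λ k → triangle n k * φ (suc k) i) +
        ∑ (suc (suc n)) (λ k → triangle n k * (weightSum n k * φ k i))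
        ≈⟨ +-congˡ (∑-head (suc n) _) ⟩
      ∑ (suc n) (λ k → triangle n k * φ (suc k) i) +
        (triangle n 0 * (weightSum n 0 * φ 0 i) +
         ∑ (suc n) (λ k → triangle n (suc k) * (weightSum n (suc k) * φ (suc k) i)))
        ≈⟨ solve 3 (λ a b c → a :+ (b :+ c) := b :+ (a :+ c)) refl _ _ _ ⟩
      triangle n 0 * (weightSum n 0 * φ 0 i) + (∑ (suc n) (λ k → triangle n k * φ (suc k) i) +
        ∑ (suc n) (λ k → triangle n (suc k) * (weightSum n (suc k) * φ (suc k) i)))
        ≈⟨ +-congˡ (∑-distrib-+ (suc n) _ _) ⟨
      triangle n 0 * (weightSum n 0 * φ 0 i) +
        ∑ (suc n) (λ k → triangle n k * φ (suc k) i + triangle n (suc k) * (weightSum n (suc k) * φ (suc k) i))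
        ≈⟨ +-cong first (∑-cong (suc n) (λ k _ → rest k)) ⟩
      triangle (suc n) 0 * φ 0 i + ∑ (suc n) (λ k → triangle (suc n) (suc k) * φ (suc k) i)
        ≈⟨ ∑-head (suc n) _ ⟨
      ∑ (suc (suc n)) (λ k → triangle (suc n) k * φ k i) ∎
      where
      first : triangle n 0 * (weightSum n 0 * φ 0 i) ≈ triangle (suc n) 0 * φ 0 i
      first = solve 3 (λ t w f → t :* (w :* f) := (w :* t) :* f) refl _ _ _
      rest : ∀ k → triangle n k * φ (suc k) i + triangle n (suc k) * (weightSum n (suc k) * φ (suc k) i)
                 ≈ triangle (suc n) (suc k) * φ (suc k) i
      rest k = solve 4 (λ t t′ w f → t :* f :+ t′ :* (w :* f) := (t :+ w :* t′) :* f) refl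
                        (triangle n k) (triangle n (suc k)) (weightSum n (suc k)) (φ (suc k) i)

    stirling-unique : ∀ {S} → IsGeneralizedStirling R α β S → ∀ n k → S n k ≈ triangle n k
    stirling-unique {S} isS n k = [ below , above ]′ (ℕ.<-≤-connex k (suc n))
      where
      open IsGeneralizedStirling isS renaming (vanishes to S-vanishes)
      above : n ℕ.< k → S n k ≈ triangle n k
      above n<k = trans (S-vanishes n k n<k) (sym (triangle-vanishes n k n<k))
      same : ∀ i → ∑ (suc n) (λ k → S n k * φ k i) ≈ ∑ (suc n) (λ k → triangle n k * φ k i)
      same i = begin
        ∑ (suc n) (λ k → S n k * φ k i)
          ≈⟨ ∑-cong (suc n) (λ k _ → coeff-·ᴾ (S n k) (falling R β k) i) ⟨
        ∑ (suc n) (λ k → coeff R (_·ᴾ_ R (S n k) (falling R β k)) i)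
          ≈⟨ coeff-sumᴾ-upTo (λ k → _·ᴾ_ R (S n k) (falling R β k)) (suc n) i ⟨
        coeff R (sumᴾ R (map (λ k → _·ᴾ_ R (S n k) (falling R β k)) (upTo (suc n)))) i
          ≈⟨ identity n i ⟨
        coeff R (rising R α n) i
          ≈⟨ rising-expansion n i ⟩
        ∑ (suc n) (λ k → triangle n k * φ k i) ∎
      below : k ℕ.< suc n → S n k ≈ triangle n k
      below = ∑-monic-injective φ
        (linearProduct-monic (λ j → - (j · β))) (linearProduct-degree (λ j → - (j · β)))
        (suc n) (S n) (triangle n) same k

-- Enumeration of the partitions into lists by inserting elements

concat-resp-↭ : ls ↭ ms → concat ls ↭ concat ms
concat-resp-↭ Permutation.refl           = ↭-refl
concat-resp-↭ (Permutation.prep l p)     = ++⁺ˡ l (concat-resp-↭ p)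
concat-resp-↭ (Permutation.swap l m p)   =
  ↭-trans (shifts l m) (++⁺ˡ m (++⁺ˡ l (concat-resp-↭ p)))
concat-resp-↭ (Permutation.trans p q)    = ↭-trans (concat-resp-↭ p) (concat-resp-↭ q)

Unique-resp-↭ : xs ↭ ys → Unique xs → Unique ys
Unique-resp-↭ p = SetoidPermutation.Unique-resp-↭ (≡.setoid _) (↭⇒↭ₛ p)

-- Lets a pairwise argument use facts known of each single entry, such as soundness of the
-- partitions being compared.
AllPairs-strengthen : ∀ {P : A → Set p} {R : A → A → Set r} →
  All P xs → AllPairs R xs → AllPairs (λ x y → P x × P y × R x y) xs
AllPairs-strengthen []         []         = []
AllPairs-strengthen (px ∷ pxs) (rx ∷ rxs) =
  All.zipWith (λ (py , rxy) → px , py , rxy) (pxs , rx) ∷ AllPairs-strengthen pxs rxs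

-- Both prefixes avoid `x`, so both end at its first occurrence. This is what makes deleting an
-- inserted element well defined.
split-unique : ∀ (as cs : List A) {bs ds} → x ∉ as → x ∉ cs →
  as ++ x ∷ bs ≡ cs ++ x ∷ ds → as ≡ cs × bs ≡ ds
split-unique []       []       _    _    eq = ≡.refl , ∷-injectiveʳ eq
split-unique []       (c ∷ cs) _    x∉cs eq = contradiction (here (∷-injectiveˡ eq)) x∉cs
split-unique (a ∷ as) []       x∉as _    eq = contradiction (here (≡.sym (∷-injectiveˡ eq))) x∉as
split-unique (a ∷ as) (c ∷ cs) x∉as x∉cs eq
  with ∷-injectiveˡ eq | split-unique as cs (x∉as ∘ there) (x∉cs ∘ there) (∷-injectiveʳ eq)
... | ≡.refl | ≡.refl , bs≡ds = ≡.refl , bs≡ds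

++-disjoint : ∀ (xs : List A) → Unique (xs ++ ys) → x ∈ xs → x ∉ ys
++-disjoint (x ∷ xs) (x∉ ∷ _) (here ≡.refl) x∈ys = All.lookup x∉ (∈-++⁺ʳ xs x∈ys) ≡.refl
++-disjoint (x ∷ xs) (_ ∷ u)  (there x∈xs)  x∈ys = ++-disjoint xs u x∈xs x∈ys

++-unique⁻ˡ : ∀ (xs : List A) → Unique (xs ++ ys) → Unique xs
++-unique⁻ˡ []       _        = []
++-unique⁻ˡ (x ∷ xs) (x∉ ∷ u) = All.++⁻ˡ xs x∉ ∷ ++-unique⁻ˡ xs u

++-unique⁻ʳ : ∀ (xs : List A) → Unique (xs ++ ys) → Unique ys
++-unique⁻ʳ []       u       = u
++-unique⁻ʳ (x ∷ xs) (_ ∷ u) = ++-unique⁻ʳ xs u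

-- Without repetitions in the concatenation, lists at different positions share no element. This
-- pins down the list that `listOf` extracts from a membership proof.
list-containing-unique : ∀ ls → Unique (concat {A = A} ls) →
  l ∈ ls → m ∈ ls → x ∈ l → x ∈ m → l ≡ m
list-containing-unique (l ∷ ls) u (here ≡.refl) (here ≡.refl) _ _ = ≡.refl
list-containing-unique (l ∷ ls) u (here ≡.refl) (there m∈) x∈l x∈m =
  contradiction (∈-concat⁺′ x∈m m∈) (++-disjoint l u x∈l)
list-containing-unique (l ∷ ls) u (there l∈) (here ≡.refl) x∈l x∈m =
  contradiction (∈-concat⁺′ x∈l l∈) (++-disjoint l u x∈m)
list-containing-unique (l ∷ ls) u (there l∈) (there m∈) x∈l x∈m =
  list-containing-unique ls (++-unique⁻ʳ l u) l∈ m∈ x∈l x∈m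

-- For a nonempty list the first entry is the insertion at the head and all others are insertions
-- after an element, which is the division into weights β and α.
insertions : A → List A → List (List A)
insertions x []       = [ [ x ] ]
insertions x (y ∷ ys) = (x ∷ y ∷ ys) ∷ map (y ∷_) (insertions x ys)

insertInto : A → List (List A) → List (List (List A))
insertInto x []       = []
insertInto x (l ∷ ls) = map (_∷ ls) (insertions x l) ++ map (l ∷_) (insertInto x ls)

-- The head of the input is the element inserted last, so a descending input inserts its elements in
-- increasing order.
partitions : List A → ℕ → List (List (List A))
partitions []       zero    = [ [] ]
partitions []       (suc k) = []
partitions (x ∷ xs) zero    = concatMap (insertInto x) (partitions xs zero)
partitions (x ∷ xs) (suc k) =
  map ([ x ] ∷_) (partitions xs k) ++ concatMap (insertInto x) (partitions xs (suc k))

IsPartition : {A : Set a} → List A → ℕ → List (List A) → Set a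
IsPartition xs k ls = length ls ≡ k × All (_≢ []) ls × concat ls ↭ xs

-- Both sides are taken up to the order of the lists, so the affected list can be moved to the front
-- and its position forgotten.
record Insertion {A : Set a} (x : A) (ls ls′ : List (List A)) : Set a where
  constructor insertion
  field
    front back : List A
    rest       : List (List A)
    original   : ls ↭ (front ++ back) ∷ rest
    result     : ls′ ↭ (front ++ x ∷ back) ∷ rest

∈-insertions⁻ : ∀ l → m ∈ insertions x l → ∃₂ λ as bs → l ≡ as ++ bs × m ≡ as ++ x ∷ bs
∈-insertions⁻ []       (here eq) = [] , [] , ≡.refl , eq
∈-insertions⁻ (y ∷ ys) (here eq) = [] , y ∷ ys , ≡.refl , eq
∈-insertions⁻ (y ∷ ys) (there m∈) with ∈-map⁻ (y ∷_) m∈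
... | m′ , m′∈ , ≡.refl with ∈-insertions⁻ ys m′∈
... | as , bs , ≡.refl , ≡.refl = y ∷ as , bs , ≡.refl , ≡.refl

∈-insertions⁺ : ∀ (as bs : List A) → as ++ x ∷ bs ∈ insertions x (as ++ bs)
∈-insertions⁺ []       []       = here ≡.refl
∈-insertions⁺ []       (b ∷ bs) = here ≡.refl
∈-insertions⁺ (a ∷ as) bs       = there (∈-map⁺ (a ∷_) (∈-insertions⁺ as bs))

inserted∈ : m ∈ insertions x l → x ∈ m
inserted∈ {l = l} m∈ with ∈-insertions⁻ l m∈
... | as , bs , _ , ≡.refl = ∈-insert as

∈-insertInto⁻ : ∀ ls → ls′ ∈ insertInto x ls → Insertion x ls ls′
∈-insertInto⁻ {x = x} (l ∷ ls) ls′∈ with ∈-++⁻ (map (_∷ ls) (insertions x l)) ls′∈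
... | inj₁ head∈ with ∈-map⁻ (_∷ ls) head∈
...   | m , m∈ , ≡.refl with ∈-insertions⁻ l m∈
...     | as , bs , ≡.refl , ≡.refl = insertion as bs ls ↭-refl ↭-refl
∈-insertInto⁻ {x = x} (l ∷ ls) ls′∈ | inj₂ tail∈ with ∈-map⁻ (l ∷_) tail∈
...   | ms , ms∈ , ≡.refl with ∈-insertInto⁻ ls ms∈
...     | insertion as bs rest orig res =
  insertion as bs (l ∷ rest)
    (↭-trans (↭-prep l orig) (↭-swap _ _ ↭-refl)) (↭-trans (↭-prep l res) (↭-swap _ _ ↭-refl))

∈-insertInto⁺ : ∀ us as bs vs →
  us ++ (as ++ x ∷ bs) ∷ vs ∈ insertInto {A = A} x (us ++ (as ++ bs) ∷ vs)
∈-insertInto⁺ []       as bs vs = ∈-++⁺ˡ (∈-map⁺ (_∷ vs) (∈-insertions⁺ as bs))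
∈-insertInto⁺ (u ∷ us) as bs vs = ∈-++⁺ʳ _ (∈-map⁺ (u ∷_) (∈-insertInto⁺ us as bs vs))

∈-partitions-new : ∀ (xs : List A) k → ls ∈ partitions xs k → [ x ] ∷ ls ∈ partitions (x ∷ xs) (suc k)
∈-partitions-new {x = x} xs k ls∈ = ∈-++⁺ˡ (∈-map⁺ ([ x ] ∷_) ls∈)

∈-partitions-old : ∀ k → ls ∈ partitions xs k → ls′ ∈ insertInto x ls → ls′ ∈ partitions (x ∷ xs) k
∈-partitions-old zero    ls∈ ls′∈ = ∈-concatMap⁺ _ (lose ls∈ ls′∈)
∈-partitions-old (suc k) ls∈ ls′∈ = ∈-++⁺ʳ _ (∈-concatMap⁺ _ (lose ls∈ ls′∈))

insertion-partition : Insertion x ls ls′ → IsPartition xs k ls → IsPartition (x ∷ xs) k ls′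
insertion-partition {x = x} {ls} {ls′} {xs} (insertion as bs rest orig res) (len , ne , cov) =
  ≡.trans (↭-length res) (≡.trans (≡.sym (↭-length orig)) len) ,
  All-resp-↭ (↭-sym res) (nonempty as ∷ All.tail (All-resp-↭ orig ne)) ,
  (begin
    concat ls′                         ↭⟨ concat-resp-↭ res ⟩
    (as ++ x ∷ bs) ++ concat rest      ↭⟨ ++⁺ʳ (concat rest) (shift x as bs) ⟩
    x ∷ (as ++ bs) ++ concat rest      ↭⟨ ↭-prep x (concat-resp-↭ orig) ⟨
    x ∷ concat ls                      ↭⟨ ↭-prep x cov ⟩
    x ∷ xs                             ∎)
  where
  open PermutationReasoning
  nonempty : ∀ as → as ++ x ∷ bs ≢ []
  nonempty []      ()
  nonempty (_ ∷ _) ()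

-- Soundness and completeness of the recursive enumeration

partitions-sound : ∀ (xs : List A) k → All (IsPartition xs k) (partitions xs k)

insertInto-sound : ∀ (x : A) xs k →
  All (IsPartition (x ∷ xs) k) (concatMap (insertInto x) (partitions xs k))
insertInto-sound x xs k = All.concat⁺ (All.map⁺ (All.map
  (λ {ls} isP → All.tabulate λ ls′∈ → insertion-partition (∈-insertInto⁻ ls ls′∈) isP)
  (partitions-sound xs k)))

partitions-sound []       zero    = (≡.refl , [] , ↭-refl) ∷ []
partitions-sound []       (suc k) = []
partitions-sound (x ∷ xs) zero    = insertInto-sound x xs zero
partitions-sound (x ∷ xs) (suc k) = All.++⁺
  (All.map⁺ (All.map (λ (len , ne , cov) → ≡.cong suc len , (λ ()) ∷ ne , ↭-prep x cov)
    (partitions-sound xs k)))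
  (insertInto-sound x xs (suc k))

-- The element `x` is deleted from its list. If the list becomes empty, it was the new list `[ x ]`;
-- otherwise the shortened partition has the same number of lists and is covered by induction.
partitions-complete : ∀ (xs : List A) k ls → IsPartition xs k ls →
  ∃ λ ms → ms ∈ partitions xs k × ms ↭ ls
partitions-complete [] k [] (≡.refl , _ , _) = [] , here ≡.refl , ↭-refl
partitions-complete [] k ([] ∷ ls) (_ , []≢[] ∷ _ , _) = contradiction ≡.refl []≢[]
partitions-complete [] k ((y ∷ l) ∷ ls) (_ , _ , cov) = contradiction cov ¬x∷xs↭[]
partitions-complete (x ∷ xs) k ls (len , ne , cov)
  with ∈-concat⁻′ ls (∈-resp-↭ (↭-sym cov) (here ≡.refl))
... | l , x∈l , l∈ls with ∈-∃++ x∈l | ∈-∃++ l∈ls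
... | as , bs , ≡.refl | us , vs , ≡.refl = byCases k
  (≡.trans (≡.sym (↭-length ls↭)) len) as bs (All.tail (All-resp-↭ ls↭ ne)) cov′ ls↭
  where
  rest = us ++ vs
  ls↭ : ls ↭ (as ++ x ∷ bs) ∷ rest
  ls↭ = shift (as ++ x ∷ bs) us vs
  cov′ : (as ++ bs) ++ concat rest ↭ xs
  cov′ = drop-∷ (begin
    x ∷ (as ++ bs) ++ concat rest     ↭⟨ ++⁺ʳ (concat rest) (shift x as bs) ⟨
    (as ++ x ∷ bs) ++ concat rest     ↭⟨ concat-resp-↭ ls↭ ⟨
    concat ls                         ↭⟨ cov ⟩
    x ∷ xs                            ∎)
    where open PermutationReasoning

  old : ∀ k as bs → suc (length rest) ≡ k → as ++ bs ≢ [] → All (_≢ []) rest →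
    (as ++ bs) ++ concat rest ↭ xs → ls ↭ (as ++ x ∷ bs) ∷ rest →
    ∃ λ ms → ms ∈ partitions (x ∷ xs) k × ms ↭ ls
  old k as bs len l≢[] ne cov ls↭
    with partitions-complete xs k ((as ++ bs) ∷ rest) (len , l≢[] ∷ ne , cov)
  -- The induction hypothesis gives the lists only up to order, so the shortened list must be found
  -- again in `ms` before `x` is put back.
  ... | ms , ms∈ , ms↭ with ∈-∃++ (∈-resp-↭ (↭-sym ms↭) (here ≡.refl))
  ... | us′ , vs′ , ≡.refl =
    us′ ++ (as ++ x ∷ bs) ∷ vs′ , ∈-partitions-old k ms∈ (∈-insertInto⁺ us′ as bs vs′) ,
    (begin
      us′ ++ (as ++ x ∷ bs) ∷ vs′     ↭⟨ shift (as ++ x ∷ bs) us′ vs′ ⟩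
      (as ++ x ∷ bs) ∷ us′ ++ vs′     ↭⟨ ↭-prep (as ++ x ∷ bs) (drop-mid us′ [] ms↭) ⟩
      (as ++ x ∷ bs) ∷ rest           ↭⟨ ls↭ ⟨
      ls                              ∎)
    where open PermutationReasoning

  byCases : ∀ k → suc (length rest) ≡ k → ∀ as bs → All (_≢ []) rest →
    (as ++ bs) ++ concat rest ↭ xs → ls ↭ (as ++ x ∷ bs) ∷ rest →
    ∃ λ ms → ms ∈ partitions (x ∷ xs) k × ms ↭ ls
  byCases (suc k) ≡.refl [] [] ne cov ls↭ with partitions-complete xs k rest (≡.refl , ne , cov)
  ... | ms , ms∈ , ms↭ = [ x ] ∷ ms , ∈-partitions-new xs (length rest) ms∈ , ↭-trans (↭-prep [ x ] ms↭) (↭-sym ls↭)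
  byCases k len []         bs@(_ ∷ _) = old k [] bs len λ ()
  byCases k len as@(_ ∷ _) bs         = old k as bs len λ ()

-- Distinctness of the enumerated partitions modulo the order of lists

∉-concat-resp-↭ : x ∉ concat ls → ls ↭ ms → x ∉ concat ms
∉-concat-resp-↭ x∉ p x∈ = x∉ (∈-resp-↭ (concat-resp-↭ (↭-sym p)) x∈)

-- Since `x` is new, the list containing it is the altered one on both sides. The two altered lists
-- therefore coincide, and deleting `x` from them recovers equivalent originals.
insertion-injective : x ∉ concat ls → x ∉ concat ms →
  Insertion x ls ls′ → Insertion x ms ms′ → ls′ ↭ ms′ → ls ↭ ms
insertion-injective {x = x} x∉ls x∉ms
  (insertion as bs rest₁ orig₁ res₁) (insertion cs ds rest₂ orig₂ res₂) p
  with ↭-trans (↭-sym res₁) (↭-trans p res₂)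
... | q with ∈-resp-↭ q (here ≡.refl)
... | there l∈ = contradiction (∈-++⁺ʳ (cs ++ ds) (∈-concat⁺′ (∈-insert as) l∈))
                               (∉-concat-resp-↭ x∉ms orig₂)
... | here eq with split-unique as cs
                     (∉-concat-resp-↭ x∉ls orig₁ ∘ ∈-++⁺ˡ ∘ ∈-++⁺ˡ)
                     (∉-concat-resp-↭ x∉ms orig₂ ∘ ∈-++⁺ˡ ∘ ∈-++⁺ˡ) eq
...   | ≡.refl , ≡.refl = ↭-trans orig₁ (↭-trans (↭-prep _ (drop-∷ q)) (↭-sym orig₂))

insertions-unique : ∀ (l : List A) → x ∉ l → Unique (insertions x l)
insertions-unique []       _   = [] ∷ []
insertions-unique (y ∷ ys) x∉l =
  All.map⁺ (All.tabulate λ _ eq → x∉l (here (∷-injectiveˡ eq))) ∷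
  AllPairs.map⁺ (AllPairs.map (_∘ ∷-injectiveʳ) (insertions-unique ys (x∉l ∘ there)))

-- Nonemptiness is essential: with two empty lists, inserting `x` into either would give the same
-- result up to order.
insertInto-unique : ∀ ls → x ∉ concat ls → Unique (concat ls) → All (_≢ []) ls →
  AllPairs (λ ms ms′ → ¬ (ms ↭ ms′)) (insertInto {A = A} x ls)
insertInto-unique []       _   _ _          = []
insertInto-unique {x = x} (l ∷ ls) x∉ u (l≢[] ∷ ne) = AllPairs.++⁺
  (AllPairs.map⁺ (AllPairs.map distinctHeads
    (AllPairs-strengthen (All.tabulate inserted∈) (insertions-unique l (x∉ ∘ ∈-++⁺ˡ)))))
  (AllPairs.map⁺ (AllPairs.map (_∘ drop-∷)
    (insertInto-unique ls (x∉ ∘ ∈-++⁺ʳ l) (++-unique⁻ʳ l u) ne)))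
  (All.map⁺ (All.tabulate λ m∈ → All.map⁺ (All.tabulate λ _ → headVsTail l≢[] u (inserted∈ m∈))))
  where
  distinctHeads : ∀ {m m′} → x ∈ m × x ∈ m′ × m ≢ m′ → ¬ (m ∷ ls ↭ m′ ∷ ls)
  distinctHeads (x∈m , _ , m≢m′) p with ∈-resp-↭ p (here ≡.refl)
  ... | here m≡m′  = m≢m′ m≡m′
  ... | there m∈ls = x∉ (∈-++⁺ʳ l (∈-concat⁺′ x∈m m∈ls))

  -- The unchanged `l` would have to occur in `m ∷ ls`. It is not `m`, which contains `x`, and a
  -- nonempty `l` cannot recur in `ls` because the concatenation has no repetition.
  headVsTail : ∀ {m ms} → l ≢ [] → Unique (l ++ concat ls) → x ∈ m → ¬ (m ∷ ls ↭ l ∷ ms)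
  headVsTail l≢[] u x∈m p with ∈-resp-↭ (↭-sym p) (here ≡.refl)
  ... | here ≡.refl = x∉ (∈-++⁺ˡ x∈m)
  ... | there l∈ls  = disjointSelf l≢[] u l∈ls
    where
    disjointSelf : ∀ {l} → l ≢ [] → Unique (l ++ concat ls) → l ∉ ls
    disjointSelf {[]}        l≢[] _ _    = l≢[] ≡.refl
    disjointSelf {l@(_ ∷ _)} _    u l∈ls = ++-disjoint l u (here ≡.refl) (∈-concat⁺′ (here ≡.refl) l∈ls)

partitions-unique : ∀ (xs : List A) k → Unique xs → AllPairs (λ ls ms → ¬ (ls ↭ ms)) (partitions xs k)

-- Results from a single partition are told apart by `insertInto-unique`, results from two
-- inequivalent ones by `insertion-injective`.
old-unique : ∀ (x : A) xs k → x ∉ xs → Unique xs →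
  AllPairs (λ ls ms → ¬ (ls ↭ ms)) (concatMap (insertInto x) (partitions xs k))
old-unique x xs k x∉xs u = AllPairs.concat⁺
  (All.map⁺ (All.map (λ {ls} isP@(_ , ne , cov) →
    insertInto-unique ls (x∉concat isP) (Unique-resp-↭ (↭-sym cov) u) ne) (partitions-sound xs k)))
  (AllPairs.map⁺ (AllPairs.map
    (λ {ls} {ms} (isP , isQ , ls≁ms) → All.tabulate λ ls′∈ → All.tabulate λ ms′∈ →
      ls≁ms ∘ insertion-injective (x∉concat isP) (x∉concat isQ)
                (∈-insertInto⁻ ls ls′∈) (∈-insertInto⁻ ms ms′∈))
    (AllPairs-strengthen (partitions-sound xs k) (partitions-unique xs k u))))
  where
  x∉concat : ∀ {ls} → IsPartition xs k ls → x ∉ concat ls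
  x∉concat (_ , _ , cov) = x∉xs ∘ ∈-resp-↭ cov

partitions-unique []       zero    _        = [] ∷ []
partitions-unique []       (suc k) _        = []
partitions-unique (x ∷ xs) zero    (x≢ ∷ u) = old-unique x xs zero (All.All¬⇒¬Any x≢) u
partitions-unique (x ∷ xs) (suc k) (x≢ ∷ u) = AllPairs.++⁺
  (AllPairs.map⁺ (AllPairs.map (_∘ drop-∷) (partitions-unique xs k u)))
  (old-unique x xs (suc k) x∉xs u)
  (All.map⁺ (All.tabulate λ _ → All.concat⁺ (All.map⁺ (All.map
    (λ {ms} isQ → All.tabulate λ ms′∈ → newVsOld isQ (∈-insertInto⁻ ms ms′∈))
    (partitions-sound xs (suc k))))))
  where
  x∉xs = All.All¬⇒¬Any x≢
  -- The list `[ x ]` is neither an untouched list, since those avoid `x`, nor the altered one,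
  -- which would have been empty before the insertion.
  newVsOld : ∀ {ls ms ms′} → IsPartition xs (suc k) ms → Insertion x ms ms′ → ¬ ([ x ] ∷ ls ↭ ms′)
  newVsOld (_ , ne , cov) (insertion as bs rest orig res) p
    with ∈-resp-↭ (↭-trans p res) (here ≡.refl)
  ... | there [x]∈ = x∉xs (∈-resp-↭ cov (∈-resp-↭ (concat-resp-↭ (↭-sym orig))
                       (∈-++⁺ʳ (as ++ bs) (∈-concat⁺′ (here ≡.refl) [x]∈))))
  ... | here eq = singleton as eq (All.head (All-resp-↭ orig ne))
    where
    singleton : ∀ as → [ x ] ≡ as ++ x ∷ bs → ¬ (as ++ bs ≢ [])
    singleton []           ≡.refl ≢[] = ≢[] ≡.refl
    singleton (_ ∷ [])     ()
    singleton (_ ∷ _ ∷ _)  ()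

-- Enumerations of a setoid agree up to permutation

module _ (S : Setoid a r) where
  open Setoid S
  open ∈ₛ S using () renaming (_∈_ to _∈ₛ_; _∉_ to _∉ₛ_)
  private module Permₛ = ↭ₛ S
  open Permₛ using () renaming (_↭_ to _↭ₛ_)
  open SetoidUnique S using () renaming (Unique to Uniqueₛ)

  -- This makes a sum independent of the chosen enumeration. The head of `xs` is cancelled against
  -- its partner in `ys`; uniqueness on both sides ensures that the remainders still have the same
  -- members.
  unique-same-members⇒↭ : ∀ {xs ys} → Uniqueₛ xs → Uniqueₛ ys →
    (∀ {z} → z ∈ₛ xs → z ∈ₛ ys) → (∀ {z} → z ∈ₛ ys → z ∈ₛ xs) → xs ↭ₛ ys
  unique-same-members⇒↭ {[]} {[]}     _ _ _ _     = Permₛ.↭-refl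
  unique-same-members⇒↭ {[]} {y ∷ ys} _ _ _ ys⊆xs = contradiction (ys⊆xs (here refl)) λ ()
  unique-same-members⇒↭ {x ∷ xs} {ys} (x∉ ∷ uxs) uys xs⊆ys ys⊆xs
    with SetoidMembership.∈-∃++ S (xs⊆ys (here refl))
  ... | us , vs , w , x≈w , ys≋ = Permₛ.↭-trans (Permₛ.↭-prep x rec) (Permₛ.↭-sym ys↭)
    where
    ys↭ : ys ↭ₛ x ∷ us ++ vs
    ys↭ = Permₛ.↭-trans (Permₛ.↭-reflexive-≋ ys≋) (SetoidPermutation.shift S (sym x≈w) us vs)
    uys′ : Uniqueₛ (x ∷ us ++ vs)
    uys′ = SetoidPermutation.Unique-resp-↭ S ys↭ uys
    ≉x : ∀ {zs} → All (λ z → ¬ x ≈ z) zs → ∀ {z} → z ∈ₛ zs → ¬ z ≈ x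
    ≉x x∉ z∈ z≈x = All.lookupₛ S (λ y≈z x≉y x≈z → x≉y (trans x≈z (sym y≈z))) x∉ z∈ (sym z≈x)
    drop-head : ∀ {z zs} → z ∈ₛ x ∷ zs → ¬ z ≈ x → z ∈ₛ zs
    drop-head (here z≈x) z≉x = contradiction z≈x z≉x
    drop-head (there z∈) _   = z∈
    rec : xs ↭ₛ us ++ vs
    rec = unique-same-members⇒↭ uxs (AllPairs.tail uys′)
      (λ z∈ → drop-head (SetoidPermutation.∈-resp-↭ S ys↭ (xs⊆ys (there z∈))) (≉x x∉ z∈))
      (λ z∈ → drop-head (ys⊆xs (SetoidPermutation.∈-resp-↭ S (Permₛ.↭-sym ys↭) (there z∈)))
                        (≉x (AllPairs.head uys′) z∈))

-- The concrete enumeration of list partitions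

AllPairs-reverse⁺ : ∀ {R : A → A → Set r} {xs} → AllPairs R xs → AllPairs (flip R) (reverse xs)
AllPairs-reverse⁺ [] = []
AllPairs-reverse⁺ {xs = x ∷ xs} (x∼ ∷ rxs) rewrite unfold-reverse x xs =
  AllPairs.++⁺ (AllPairs-reverse⁺ rxs) ([] ∷ [])
    (All-resp-↭ (↭-sym (↭-reverse xs)) (All.map (_∷ []) x∼))

sorted⇒unique : ∀ {xs : List (Fin n)} → AllPairs Fin._>_ xs → Unique xs
sorted⇒unique = AllPairs.map λ i>j i≡j → Fin.<⇒≢ i>j (≡.sym i≡j)

descending : ∀ n → List (Fin n)
descending n = reverse (allFin n)

descending-sorted : ∀ n → AllPairs Fin._>_ (descending n)
descending-sorted n = AllPairs-reverse⁺ (AllPairs.tabulate⁺-< λ i<j → i<j)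

toListPartition : ∀ {ls} → IsPartition (descending n) k ls → ListPartition n k
toListPartition {n} {ls = ls} (len , ne , cov) = record
  { lists = ls ; count = len ; nonEmpty = ne ; covers = ↭-trans cov (↭-reverse (allFin n)) }

isPartition : (ε : ListPartition n k) → IsPartition (descending n) k (lists ε)
isPartition {n} ε = count ε , nonEmpty ε , ↭-trans (covers ε) (↭-sym (↭-reverse (allFin n)))

listPartitions : ∀ n k → List (ListPartition n k)
listPartitions n k = All.reduce toListPartition (partitions-sound (descending n) k)

-- Attaching the soundness proofs leaves the underlying lists as they are, so completeness and
-- uniqueness transfer from `partitions`.
map-lists-listPartitions : ∀ n k → map lists (listPartitions n k) ≡ partitions (descending n) k
map-lists-listPartitions n k = go (partitions-sound (descending n) k)
  where
  go : ∀ {lss} (ps : All (IsPartition (descending n) k) lss) →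
       map lists (All.reduce toListPartition ps) ≡ lss
  go []       = ≡.refl
  go (p ∷ ps) = ≡.cong (_ ∷_) (go ps)

enumeration : ∀ n k → Enumeration (Ω n k)
enumeration n k = record
  { elements = listPartitions n k
  ; complete = λ ε → let ms , ms∈ , ms↭ = partitions-complete (descending n) k (lists ε) (isPartition ε) in
      Any.map⁻ (≡.subst (Any (lists ε ↭_)) (≡.sym (map-lists-listPartitions n k))
        (Any.map (λ { ≡.refl → ↭-sym ms↭ }) ms∈))
  ; unique   = AllPairs.map⁻ (≡.subst (AllPairs (λ ls ms → ¬ (ls ↭ ms)))
      (≡.sym (map-lists-listPartitions n k))
      (partitions-unique (descending n) k
        (sorted⇒unique (descending-sorted n))))
  }

-- Weights of partitions into lists

-- A sublist that avoids `x` must skip the inserted entry. Hence the relative order of other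
-- elements is unaffected by the insertion.
⊆-uninsert : ∀ {x : A} {zs} as {bs} → All (_≢ x) zs → zs ⊆ as ++ x ∷ bs → zs ⊆ as ++ bs
⊆-uninsert []       _          (_ Sublist.∷ʳ p)      = p
⊆-uninsert []       (z≢x ∷ _)  (≡.refl Sublist.∷ p)  = contradiction ≡.refl z≢x
⊆-uninsert (a ∷ as) zs≢x       (_ Sublist.∷ʳ p)      = a Sublist.∷ʳ ⊆-uninsert as zs≢x p
⊆-uninsert (a ∷ as) (_ ∷ zs≢x) (≡.refl Sublist.∷ p)  = ≡.refl Sublist.∷ ⊆-uninsert as zs≢x p

module Weights {c ℓ : Level} (R : CommutativeRing c ℓ)
               (α β : CommutativeRing.Carrier R) where

  open CommutativeRing R hiding (zero)
  open import Algebra.Definitions.RawMonoid +-rawMonoid using () renaming (_×_ to _·_)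
  open import Relation.Binary.Reasoning.Setoid setoid
  open SemiringSolver commutativeSemiring using (solve; _:=_; _:+_; _:*_)
  open Polynomials R using (triangle; weightSum)

  -- Finite sums and products over lists

  sum product : (A → Carrier) → List A → Carrier
  sum     f xs = foldr _+_ 0# (map f xs)
  product f xs = foldr _*_ 1# (map f xs)

  sum-++ : ∀ (f : A → Carrier) xs {ys} → sum f (xs ++ ys) ≈ sum f xs + sum f ys
  sum-++ f []       = sym (+-identityˡ _)
  sum-++ f (x ∷ xs) = trans (+-congˡ (sum-++ f xs)) (sym (+-assoc _ _ _))

  sum-map : ∀ (f : B → Carrier) (g : A → B) xs → sum f (map g xs) ≈ sum (f ∘ g) xs
  sum-map f g xs = reflexive (≡.cong (foldr _+_ 0#) (≡.sym (map-∘ xs)))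

  sum-cong : ∀ {f g : A → Carrier} {xs} → All (λ x → f x ≈ g x) xs → sum f xs ≈ sum g xs
  sum-cong []         = refl
  sum-cong (eq ∷ eqs) = +-cong eq (sum-cong eqs)

  sum-concatMap : ∀ (f : B → Carrier) (g : A → List B) xs → sum f (concatMap g xs) ≈ sum (sum f ∘ g) xs
  sum-concatMap f g []       = refl
  sum-concatMap f g (x ∷ xs) = trans (sum-++ f (g x)) (+-congˡ (sum-concatMap f g xs))

  sum-distribˡ : ∀ u (f : A → Carrier) xs → u * sum f xs ≈ sum (λ x → u * f x) xs
  sum-distribˡ u f []       = zeroʳ u
  sum-distribˡ u f (x ∷ xs) = trans (distribˡ u _ _) (+-congˡ (sum-distribˡ u f xs))

  sum-distribʳ : ∀ u (f : A → Carrier) xs → sum f xs * u ≈ sum (λ x → f x * u) xs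
  sum-distribʳ u f []       = zeroˡ u
  sum-distribʳ u f (x ∷ xs) = trans (distribʳ u _ _) (+-congˡ (sum-distribʳ u f xs))

  sum-const : ∀ {u} {f : A → Carrier} {xs} → All (λ x → f x ≈ u) xs → sum f xs ≈ length xs · u
  sum-const []         = refl
  sum-const (eq ∷ eqs) = +-cong eq (sum-const eqs)

  product-++ : ∀ (f : A → Carrier) xs {ys} → product f (xs ++ ys) ≈ product f xs * product f ys
  product-++ f []       = sym (*-identityˡ _)
  product-++ f (x ∷ xs) = trans (*-congˡ (product-++ f xs)) (sym (*-assoc _ _ _))

  product-concat : ∀ (f : A → Carrier) ls → product f (concat ls) ≈ product (product f) ls
  product-concat f []       = refl
  product-concat f (l ∷ ls) = trans (product-++ f l) (*-congˡ (product-concat f ls))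

  product-cong : ∀ {f g : A → Carrier} {xs} → All (λ x → f x ≈ g x) xs → product f xs ≈ product g xs
  product-cong []         = refl
  product-cong (eq ∷ eqs) = *-cong eq (product-cong eqs)

  product-resp-↭ : ∀ (f : A → Carrier) {xs ys} → xs ↭ ys → product f xs ≈ product f ys
  product-resp-↭ f p = SetoidPermutation.foldr-commMonoid setoid *-isCommutativeMonoid
    (↭⇒↭ₛ′ isEquivalence (↭-map⁺ f p))

  sumOver-cong : {S : Setoid a r} (E E′ : Enumeration S) {f : Setoid.Carrier S → Carrier} →
    (∀ {x y} → Setoid._≈_ S x y → f x ≈ f y) → sumOver R E f ≈ sumOver R E′ f
  sumOver-cong {S = S} E E′ resp = SetoidPermutation.foldr-commMonoid setoid +-isCommutativeMonoid
    (SetoidPermutation.map⁺ S setoid resp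
      (unique-same-members⇒↭ S (unique E) (unique E′) (λ _ → complete E′ _) (λ _ → complete E _)))

  -- The weight as a product over the lists of a partition

  listWeight : List (Fin n) → Carrier
  listWeight l = product (elementWeight R α β l) l

  totalWeight : List (List (Fin n)) → Carrier
  totalWeight = product listWeight

  -- `covers` regroups the product over all elements by lists, and disjointness of the lists
  -- identifies `listOf ε e` with the list in which `e` is met.
  weight≈totalWeight : (ε : ListPartition n k) → weight R α β ε ≈ totalWeight (lists ε)
  weight≈totalWeight {n} ε = begin
    product w (allFin n)                 ≈⟨ product-resp-↭ w (covers ε) ⟨
    product w (concat (lists ε))         ≈⟨ product-concat w (lists ε) ⟩
    product (product w) (lists ε)        ≈⟨ product-cong (All.tabulate λ l∈ →
      product-cong (All.tabulate λ {e} e∈ → reflexive (≡.cong (λ l → elementWeight R α β l e) (listOf≡ l∈ e∈)))) ⟩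
    totalWeight (lists ε)                ∎
    where
    w : Fin n → Carrier
    w e = elementWeight R α β (listOf ε e) e
    unique-concat : Unique (concat (lists ε))
    unique-concat = Unique-resp-↭ (↭-sym (covers ε)) (AllPairs.tabulate⁺ λ i≢j → i≢j)
    listOf≡ : ∀ {l e} → l ∈ lists ε → e ∈ l → listOf ε e ≡ l
    listOf≡ {e = e} l∈ e∈l =
      let _ , e∈ , listOf∈ = ∈-concat⁻′ (lists ε) (∈-resp-↭ (↭-sym (covers ε)) (∈-allFin e))
      in list-containing-unique (lists ε) unique-concat listOf∈ l∈ e∈ e∈l

  weight-cong : ∀ {ε ε′ : ListPartition n k} → lists ε ↭ lists ε′ → weight R α β ε ≈ weight R α β ε′
  weight-cong {ε = ε} {ε′} p = trans (weight≈totalWeight ε)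
    (trans (product-resp-↭ listWeight p) (sym (weight≈totalWeight ε′)))

  -- Effect on the weights of inserting a largest element

  module _ {x : Fin n} where

    -- Both tests on `e` ignore the larger `x`: `e ≤ x` holds anyway, and `x < e` is false, so `x`
    -- imposes no order condition. Order conditions between the other elements survive adding or
    -- removing `x`.
    elementWeight-smaller : ∀ as {bs e} → All (Fin._< x) (as ++ bs) → e Fin.< x →
      elementWeight R α β (as ++ x ∷ bs) e ≡ elementWeight R α β (as ++ bs) e
    elementWeight-smaller as {bs} {e} <x e<x = ≡.cong₂ (λ s p → if s then 1# else if p then β else α)
      (does-⇔ (mk⇔ (All.tail ∘ All-resp-↭ (shift x as bs))
                   (All-resp-↭ (↭-sym (shift x as bs)) ∘ (ℕ.<⇒≤ e<x ∷_)))
        (smallest? (as ++ x ∷ bs) e) (smallest? (as ++ bs) e))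
      (does-⇔ (mk⇔ (λ p → All.map (λ q d<e → ⊆-uninsert as
                       (Fin.<⇒≢ e<x ∷ Fin.<⇒≢ (Fin.<-trans d<e e<x) ∷ []) (q d<e))
                       (All.tail (All-resp-↭ (shift x as bs) p)))
                   (λ p → All-resp-↭ (↭-sym (shift x as bs))
                       ((λ x<e → contradiction x<e (Fin.<-asym e<x)) ∷
                        All.map (λ q d<e → ⊆-trans (q d<e) (++⁺ (⊆-refl {x = as}) (x Sublist.∷ʳ ⊆-refl))) p)))
        (precedesSmaller? (as ++ x ∷ bs) e) (precedesSmaller? (as ++ bs) e))

    listWeight-insert : ∀ as {bs} → All (Fin._< x) (as ++ bs) →
      listWeight (as ++ x ∷ bs) ≈ elementWeight R α β (as ++ x ∷ bs) x * listWeight (as ++ bs)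
    listWeight-insert as {bs} <x = trans (product-resp-↭ _ (shift x as bs)) (*-congˡ
      (product-cong (All.map (λ e<x → reflexive (elementWeight-smaller as <x e<x)) <x)))

    not-smallest : ∀ {l y} → y ∈ l → y Fin.< x → ¬ Smallest l x
    not-smallest y∈l y<x smallest = ℕ.<⇒≱ y<x (All.lookup smallest y∈l)

    elementWeight-head : ∀ {y ys} → All (Fin._< x) (y ∷ ys) → elementWeight R α β (x ∷ y ∷ ys) x ≡ β
    elementWeight-head {y} {ys} <x@(y<x ∷ _)
      rewrite dec-false (smallest? (x ∷ y ∷ ys) x) (not-smallest (there (here ≡.refl)) y<x)
            | dec-true (precedesSmaller? (x ∷ y ∷ ys) x)
                ((λ x<x → contradiction x<x (ℕ.<-irrefl ≡.refl)) ∷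
                 All.tabulate λ d∈ _ → ≡.refl Sublist.∷ from∈ d∈)
      = ≡.refl

    -- `y` stands at the head and occurs nowhere else, so it cannot follow `x`.
    not-precedes : ∀ {y} as {bs} → Unique (y ∷ as ++ bs) → y Fin.< x →
      ¬ ((x ∷ y ∷ []) ⊆ (y ∷ as ++ x ∷ bs))
    not-precedes as      _        y<x (≡.refl Sublist.∷ _) = Fin.<⇒≢ y<x ≡.refl
    not-precedes as {bs} (y∉ ∷ _) y<x (_ Sublist.∷ʳ p)
      with ∈-resp-↭ (shift x as bs) (lookup p (there (here ≡.refl)))
    ... | here y≡x = Fin.<⇒≢ y<x y≡x
    ... | there y∈ = All.lookup y∉ y∈ ≡.refl

    -- Wherever in the tail `x` is placed, the head `y` is a smaller element standing before it, and
    -- this one witness refutes both tests.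
    elementWeight-after : ∀ {y} as {bs} → Unique (y ∷ as ++ bs) → y Fin.< x →
      elementWeight R α β (y ∷ as ++ x ∷ bs) x ≡ α
    elementWeight-after {y} as {bs} u y<x
      rewrite dec-false (smallest? (y ∷ as ++ x ∷ bs) x) (not-smallest (here ≡.refl) y<x)
            | dec-false (precedesSmaller? (y ∷ as ++ x ∷ bs) x)
                (λ p → not-precedes as u y<x (All.head p y<x))
      = ≡.refl

    length-insertions : ∀ (l : List (Fin n)) → length (insertions x l) ≡ suc (length l)
    length-insertions []       = ≡.refl
    length-insertions (y ∷ ys) = ≡.cong suc (≡.trans (length-map (y ∷_) (insertions x ys)) (length-insertions ys))

    -- The head position costs β. The other entries insert into the tail `ys` at `suc (length ys)`
    -- places, one after each element of `y ∷ ys`, at cost α. For an empty list the sole insertion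
    -- would cost 1 instead of β, whence `l ≢ []`.
    sum-insertions : ∀ l → l ≢ [] → All (Fin._< x) l → Unique l →
      sum listWeight (insertions x l) ≈ (β + length l · α) * listWeight l
    sum-insertions []       l≢[] _ _ = contradiction ≡.refl l≢[]
    sum-insertions (y ∷ ys) _ <x u = begin
      listWeight (x ∷ y ∷ ys) + sum listWeight (map (y ∷_) (insertions x ys))
        ≈⟨ +-cong (trans (listWeight-insert [] <x) (*-congʳ (reflexive (elementWeight-head <x))))
                  (sum-const (All.tabulate after)) ⟩
      β * w + length (map (y ∷_) (insertions x ys)) · (α * w)
        ≡⟨ ≡.cong (λ m → β * w + m · (α * w))
             (≡.trans (length-map (y ∷_) (insertions x ys)) (length-insertions ys)) ⟩
      β * w + length (y ∷ ys) · (α * w)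
        ≈⟨ +-congˡ (×-assoc-* (length (y ∷ ys)) α w) ⟨
      β * w + length (y ∷ ys) · α * w
        ≈⟨ distribʳ w β _ ⟨
      (β + length (y ∷ ys) · α) * w ∎
      where
      open import Algebra.Properties.Semiring.Mult semiring using (×-assoc-*)
      w = listWeight (y ∷ ys)
      after : ∀ {m} → m ∈ map (y ∷_) (insertions x ys) → listWeight m ≈ α * w
      after m∈ with ∈-map⁻ (y ∷_) m∈
      ... | m′ , m′∈ , ≡.refl with ∈-insertions⁻ ys m′∈
      ...   | as , bs , ≡.refl , ≡.refl = trans (listWeight-insert (y ∷ as) <x)
                (*-congʳ (reflexive (elementWeight-after as u (All.head <x))))

    -- Lists not receiving `x` keep their weight as a common factor, so the costs of the separate
    -- lists add up: β for each list and α for each element.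
    sum-insertInto : ∀ ls → All (_≢ []) ls → All (Fin._< x) (concat ls) → Unique (concat ls) →
      sum totalWeight (insertInto x ls) ≈ weightSum α β (length (concat ls)) (length ls) * totalWeight ls
    -- Without lists there is nowhere to insert, and `weightSum` is correspondingly zero.
    sum-insertInto [] _ _ _ = sym (trans (*-congʳ (+-identityˡ 0#)) (zeroˡ _))
    sum-insertInto (l ∷ ls) (l≢[] ∷ ne) <x u = begin
      sum totalWeight (map (_∷ ls) (insertions x l) ++ map (l ∷_) (insertInto x ls))
        ≈⟨ sum-++ totalWeight (map (_∷ ls) (insertions x l)) ⟩
      sum totalWeight (map (_∷ ls) (insertions x l)) + sum totalWeight (map (l ∷_) (insertInto x ls))
        ≈⟨ +-cong (sum-map totalWeight (_∷ ls) (insertions x l)) (sum-map totalWeight (l ∷_) (insertInto x ls)) ⟩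
      sum (λ m → listWeight m * W) (insertions x l) + sum (λ ms → w * totalWeight ms) (insertInto x ls)
        ≈⟨ +-cong (sum-distribʳ W listWeight (insertions x l)) (sum-distribˡ w totalWeight (insertInto x ls)) ⟨
      sum listWeight (insertions x l) * W + w * sum totalWeight (insertInto x ls)
        ≈⟨ +-cong (*-congʳ (sum-insertions l l≢[] (All.++⁻ˡ l <x) (++-unique⁻ˡ l u)))
                  (*-congˡ (sum-insertInto ls ne (All.++⁻ʳ l <x) (++-unique⁻ʳ l u))) ⟩
      (β + length l · α) * w * W + w * ((length ls · β + length (concat ls) · α) * W)
        ≈⟨ solve 6 (λ b a k m w W → (b :+ a) :* w :* W :+ w :* ((k :+ m) :* W)
                                 := ((b :+ k) :+ (a :+ m)) :* (w :* W)) refl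
             β (length l · α) (length ls · β) (length (concat ls) · α) w W ⟩
      ((β + length ls · β) + (length l · α + length (concat ls) · α)) * (w * W)
        ≈⟨ *-congʳ (+-congˡ (×-homo-+ α (length l) (length (concat ls)))) ⟨
      ((β + length ls · β) + (length l ℕ.+ length (concat ls)) · α) * (w * W)
        ≡⟨ ≡.cong (λ m → ((β + length ls · β) + m · α) * (w * W)) (length-++ l) ⟨
      weightSum α β (length (l ++ concat ls)) (suc (length ls)) * (w * W) ∎
      where
      open import Algebra.Properties.Monoid.Mult +-monoid using (×-homo-+)
      w = listWeight l
      W = totalWeight ls

  -- The recurrence for the weighted sum

  listWeight-singleton : (x : Fin n) → listWeight [ x ] ≈ 1#
  listWeight-singleton x rewrite dec-true (smallest? [ x ] x) (ℕ.≤-refl ∷ []) = *-identityʳ 1#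

  sum-partitions : ∀ (xs : List (Fin n)) k → AllPairs Fin._>_ xs →
    sum totalWeight (partitions xs k) ≈ triangle α β (length xs) k

  -- The cost of inserting `x` depends only on the numbers of lists and elements, which are the same
  -- for every partition in the sum, so it factors out.
  sum-old : ∀ x (xs : List (Fin n)) k → AllPairs Fin._>_ (x ∷ xs) →
    sum totalWeight (concatMap (insertInto x) (partitions xs k)) ≈
    weightSum α β (length xs) k * triangle α β (length xs) k
  sum-old x xs k (x> ∷ xs>) = begin
    sum totalWeight (concatMap (insertInto x) (partitions xs k))
      ≈⟨ sum-concatMap totalWeight (insertInto x) (partitions xs k) ⟩
    sum (sum totalWeight ∘ insertInto x) (partitions xs k)
      ≈⟨ sum-cong (All.map step (partitions-sound xs k)) ⟩
    sum (λ ls → weightSum α β (length xs) k * totalWeight ls) (partitions xs k)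
      ≈⟨ sum-distribˡ _ totalWeight (partitions xs k) ⟨
    weightSum α β (length xs) k * sum totalWeight (partitions xs k)
      ≈⟨ *-congˡ (sum-partitions xs k xs>) ⟩
    weightSum α β (length xs) k * triangle α β (length xs) k ∎
    where
    step : ∀ {ls} → IsPartition xs k ls →
      sum totalWeight (insertInto x ls) ≈ weightSum α β (length xs) k * totalWeight ls
    step {ls} (len , ne , cov) = trans
      (sum-insertInto ls ne (All-resp-↭ (↭-sym cov) x>) (Unique-resp-↭ (↭-sym cov)
        (sorted⇒unique xs>)))
      (*-congʳ (reflexive (≡.cong₂ (weightSum α β) (↭-length cov) len)))

  sum-partitions []       zero    _  = +-identityʳ 1#
  sum-partitions []       (suc k) _  = refl
  sum-partitions (x ∷ xs) zero    x> = sum-old x xs zero x>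
  sum-partitions (x ∷ xs) (suc k) x>@(_ ∷ xs>) = begin
    sum totalWeight (map ([ x ] ∷_) (partitions xs k) ++ concatMap (insertInto x) (partitions xs (suc k)))
      ≈⟨ sum-++ totalWeight (map ([ x ] ∷_) (partitions xs k)) ⟩
    sum totalWeight (map ([ x ] ∷_) (partitions xs k)) +
      sum totalWeight (concatMap (insertInto x) (partitions xs (suc k)))
      ≈⟨ +-cong (sum-map totalWeight ([ x ] ∷_) (partitions xs k)) (sum-old x xs (suc k) x>) ⟩
    sum (λ ls → listWeight [ x ] * totalWeight ls) (partitions xs k) + _
      ≈⟨ +-congʳ (sum-cong {xs = partitions xs k} (All.tabulate λ _ →
           trans (*-congʳ (listWeight-singleton x)) (*-identityˡ _))) ⟩
    sum totalWeight (partitions xs k) + _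
      ≈⟨ +-congʳ (sum-partitions xs k xs>) ⟩
    triangle α β (suc (length xs)) (suc k) ∎

  sumOver-weight : ∀ n k (E : Enumeration (Ω n k)) → sumOver R E (weight R α β) ≈ triangle α β n k
  sumOver-weight n k E = begin
    sumOver R E (weight R α β)
      -- The arbitrary `E` is exchanged for the concrete enumeration; this requires the weight to
      -- respect reordering of the lists.
      ≈⟨ sumOver-cong E (enumeration n k) (λ {ε} {ε′} → weight-cong {ε = ε} {ε′}) ⟩
    sum (weight R α β) (listPartitions n k)
      ≈⟨ sum-cong {xs = listPartitions n k} (All.tabulate λ {ε} _ → weight≈totalWeight ε) ⟩
    sum (totalWeight ∘ lists) (listPartitions n k)
      ≈⟨ sum-map totalWeight lists (listPartitions n k) ⟨
    sum totalWeight (map lists (listPartitions n k))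
      ≡⟨ ≡.cong (sum totalWeight) (map-lists-listPartitions n k) ⟩
    sum totalWeight (partitions (descending n) k)
      ≈⟨ sum-partitions (descending n) k (descending-sorted n) ⟩
    triangle α β (length (descending n)) k
      ≡⟨ ≡.cong (λ m → triangle α β m k) (≡.trans (length-reverse (allFin n)) (length-tabulate {n = n} (λ i → i))) ⟩
    triangle α β n k ∎

-- Supplying an enumeration along with the formula keeps the quantification over all `E` from being
-- vacuous.
theorem1 : ∀ {c ℓ} (R : CommutativeRing c ℓ) → let open CommutativeRing R in
    (α β : Carrier) (S : ℕ → ℕ → Carrier) → IsGeneralizedStirling R α β S →
    (n k : ℕ) →
    Enumeration (Ω n k) ×
    ((E : Enumeration (Ω n k)) → S n k ≈ sumOver R E (weight R α β))
theorem1 R α β S isS n k = enumeration n k , λ E →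
  trans (Polynomials.stirling-unique R α β isS n k) (sym (Weights.sumOver-weight R α β n k E))
  where open CommutativeRing R using (trans; sym)
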